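{- Let $B\ge 1$ and $m\ge 1$ be integers. For any randomized online algorithm RAND for the packet buffering problem in the standard (integral) model with $m$ buffers of size $B$ whose competitive ratio is $R$, there exists a deterministic online algorithm FRAC for the fractional model with the same buffer size $B$ and the same number of buffers $m$ whose competitive ratio is at most $R$.
   Context: Packet buffering problem (unweighted FIFO buffer management): there are $m$ buffers, each able to store up to $B$ unit-size, unit-value packets; all buffers are initially empty. An input $\sigma$ is a finite sequence of injections: at each integer time $t\ge 0$ an arbitrary (integral, possibly zero) number of packets is injected into each buffer. Packets exceeding the capacity $B$ of a buffer are lost; injection is instantaneous. Then, during the step $(t,t+1)$, an algorithm in the standard (integral) model may transmit a single packet from one non-empty buffer of its choice. After the last injection the algorithm has sufficient time to transmit all packets remaining in its buffers. The throughput $T_A(\sigma)$ of an algorithm $A$ on $\sigma$ is the total number of packets it transmits (its expected value if $A$ is randomized). OPT is the optimal offline integral algorithm (it knows $\sigma$ in advance and maximizes throughput). Fractional model: a fractional algorithm is deterministic and keeps a real load in $[0,B]$ in each buffer. Injecting $p$ packets into a buffer of load $x$ changes the load to $\min(B,x+p)$. In each step it may transmit arbitrary non-negative real amounts from the buffers (at most the current load from each buffer), of total at most 1. Its throughput is the total load transmitted. Injected packets are still integral and injected at integer times. An algorithm is online if its decision in step $(t,t+1)$ depends only on the injections up to and including time $t$ (and on its random bits, if it is randomized). The adversary is oblivious: the input does not depend on the random bits. In both models the competitive ratio of an online algorithm ALG is $\sup_\sigma T_{\mathrm{OPT}}(\sigma)/T_{\mathrm{ALG}}(\sigma)$ over all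 inputs $\sigma$ containing at least one packet, where OPT is the integral optimum. -}

module Defs where

open import Algebra.Bundles using (CommutativeRing)
open import Data.Bool.Base using (if_then_else_)
open import Data.Fin.Base using (Fin; toℕ)
import Data.Fin.Properties as Fin
open import Data.List.Base as List using (List; []; _∷_; length)
open import Data.Maybe.Base using (Maybe; just; nothing)
open import Data.Nat.Base as ℕ using (ℕ; suc)
import Data.Nat.Properties as ℕ
open import Data.Product.Base using (∃; ∃-syntax; _×_)
open import Data.Unit.Base using (⊤)
open import Data.Vec.Base as Vec using (Vec; lookup)
open import Data.Vec.Functional using (Vector)
open import Function.Base using (_∘_)
open import Level using (0ℓ)
open import Relation.Binary.Bundles using (TotalOrder)
open import Relation.Binary.Core using (Rel)
open import Relation.Binary.PropositionalEquality.Core using (_≡_; _≢_)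
open import Relation.Binary.Structures using (IsTotalOrder)
open import Relation.Nullary.Decidable.Core using (does)
open import Relation.Nullary.Negation.Core using (¬_)
open import Relation.Unary using (Pred; U; ∁; ⋃; _≐_; _⊥_)
import Algebra.Construct.NaturalChoice.Min as Min
import Algebra.Definitions.RawMonoid as RawMonoid
import Algebra.Properties.Monoid.Sum as Sum

-- The real numbers, characterised as a Dedekind-complete ordered field.
-- Since the order is total and bounded families have suprema, these are
-- the classical reals.
record RealNumbers : Set₁ where
  field
    commutativeRing : CommutativeRing 0ℓ 0ℓ

  open CommutativeRing commutativeRing public

  infix  4 _≤_ _<_
  infix  8 _⁻¹
  infixl 7 _/_

  field
    _≤_          : Rel Carrier 0ℓ
    isTotalOrder : IsTotalOrder _≈_ _≤_
    _⁻¹          : Carrier → Carrier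

  _<_ : Rel Carrier 0ℓ
  x < y = x ≤ y × ¬ (x ≈ y)

  _/_ : Carrier → Carrier → Carrier
  x / y = x * y ⁻¹

  UpperBound : {I : Set} → (I → Carrier) → Carrier → Set
  UpperBound f u = ∀ i → f i ≤ u

  IsSupremum : {I : Set} → (I → Carrier) → Carrier → Set
  IsSupremum f s = UpperBound f s × (∀ u → UpperBound f u → s ≤ u)

  field
    0≉1        : ¬ (0# ≈ 1#)
    -- 0# ⁻¹ is unspecified.
    ⁻¹-inverse : ∀ x → ¬ (x ≈ 0#) → x * x ⁻¹ ≈ 1#
    +-monoʳ-≤  : ∀ x {y z} → y ≤ z → x + y ≤ x + z
    *-nonNeg   : ∀ {x y} → 0# ≤ x → 0# ≤ y → 0# ≤ x * y
    complete   : {I : Set} (f : I → Carrier) → I →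
                 ∃ (UpperBound f) → ∃ (IsSupremum f)

  totalOrder : TotalOrder 0ℓ 0ℓ 0ℓ
  totalOrder = record { isTotalOrder = isTotalOrder }

  open Min totalOrder public using (_⊓_)
  open Sum +-monoid public using (sum; sum-syntax; sum⁺-syntax)

  fromℕ : ℕ → Carrier
  fromℕ n = RawMonoid._×_ +-rawMonoid n 1#

module ℕSum = Sum ℕ.+-0-monoid

module _ (ℝ : RealNumbers) where
  open RealNumbers ℝ

  record ProbabilitySpace : Set₁ where
    field
      Ω     : Set
      Event : Pred (Pred Ω 0ℓ) 0ℓ
      -- Only the values of P on events are meaningful.
      P     : Pred Ω 0ℓ → Carrier

      Event-resp-≐ : ∀ {A B} → A ≐ B → Event A → Event B
      Event-U      : Event U
      Event-∁      : ∀ {A} → Event A → Event (∁ A)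
      Event-⋃      : (A : ℕ → Pred Ω 0ℓ) → (∀ n → Event (A n)) →
                     Event (⋃ ℕ A)

      P-resp-≐     : ∀ {A B} → Event A → A ≐ B → P A ≈ P B
      P-nonNeg     : ∀ {A} → Event A → 0# ≤ P A
      P-U          : P U ≈ 1#
      -- For a series of non-negative terms, being the sum means being the
      -- supremum of the partial sums.
      P-⋃          : (A : ℕ → Pred Ω 0ℓ) → (∀ n → Event (A n)) →
                     (∀ {i j} → i ≢ j → A i ⊥ A j) →
                     IsSupremum (λ n → ∑[ i < n ] P (A (toℕ i))) (P (⋃ ℕ A))

    -- Expectation of a random variable with values in {0, …, N}.
    𝔼 : (N : ℕ) → (Ω → ℕ) → Carrier
    𝔼 N X = ∑[ k ≤ N ] (fromℕ (toℕ k) * P (λ ω → X ω ≡ toℕ k))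

-- The numbers of packets injected into the m buffers at one time.
Injection : ℕ → Set
Injection m = Vec ℕ m

-- A finite sequence of injections, the most recent one first: the input
-- p ∷ h ends with injection p at time length h, and the suffixes of an input
-- are exactly what has been revealed at earlier times.
Input : ℕ → Set
Input m = List (Injection m)

packets : ∀ {m} → Input m → ℕ
packets = List.sum ∘ List.map Vec.sum

module Integral (B m : ℕ) where

  -- The buffer to transmit a packet from, if any.
  Action : Set
  Action = Maybe (Fin m)

  sent : Action → Vector ℕ m
  sent nothing  i = 0
  sent (just j) i = if does (i Fin.≟ j) then 1 else 0

  -- The action taken in the step following the last injection of a
  -- (non-empty) history.  The value at [] is never used.
  Strategy : Set
  Strategy = Input m → Action

  inject : Injection m → Vector ℕ m → Vector ℕ m
  inject p x i = B ℕ.⊓ (x i ℕ.+ lookup p i)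

  -- The loads after the step following the last injection.
  load : Strategy → Input m → Vector ℕ m
  load d []      i = 0
  load d (p ∷ h) i = inject p (load d h) i ℕ.∸ sent (d (p ∷ h)) i

  -- Packets are transmitted from non-empty buffers only.
  Feasible : Strategy → Input m → Set
  Feasible d []      = ⊤
  Feasible d (p ∷ h) =
    Feasible d h × (∀ i → sent (d (p ∷ h)) i ℕ.≤ inject p (load d h) i)

  transmitted : Strategy → Input m → ℕ
  transmitted d []      = 0
  transmitted d (p ∷ h) = transmitted d h ℕ.+ ℕSum.sum (sent (d (p ∷ h)))

  -- There is sufficient time after the last injection to transmit all the
  -- packets that remain in the buffers, so these count as well.
  throughput : Strategy → Input m → ℕ
  throughput d σ = transmitted d σ ℕ.+ ℕSum.sum (load d σ)

  -- An offline schedule for a fixed input: s n is the action in the step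
  -- following the n-th injection, and may depend on the whole input.
  offline : (ℕ → Action) → Strategy
  offline s = s ∘ length

  IsOPT : Input m → ℕ → Set
  IsOPT σ k =
      (∃[ s ] Feasible (offline s) σ × throughput (offline s) σ ≡ k)
    × (∀ s → Feasible (offline s) σ → throughput (offline s) σ ℕ.≤ k)

module _ (ℝ : RealNumbers) (B m : ℕ) where
  open RealNumbers ℝ
  open Integral B m

  -- A random choice among deterministic online algorithms; the outcome ω
  -- plays the role of the random bits.
  record RandomizedAlgorithm : Set₁ where
    field
      space      : ProbabilitySpace ℝ
    open ProbabilitySpace space public
    field
      strategy   : Ω → Strategy
      feasible   : ∀ ω σ → Feasible (strategy ω) σ
      measurable : ∀ σ a → Event (λ ω → strategy ω σ ≡ a)

    -- The throughput never exceeds the number of injected packets.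
    expectedThroughput : Input m → Carrier
    expectedThroughput σ = 𝔼 (packets σ) (λ ω → throughput (strategy ω) σ)

  module Fractional where

    -- As in the integral model, but with the amounts transmitted from the
    -- individual buffers.
    FracStrategy : Set
    FracStrategy = Input m → Vector Carrier m

    fracInject : Injection m → Vector Carrier m → Vector Carrier m
    fracInject p x i = fromℕ B ⊓ (x i + fromℕ (lookup p i))

    fracLoad : FracStrategy → Input m → Vector Carrier m
    fracLoad d []      i = 0#
    fracLoad d (p ∷ h) i = fracInject p (fracLoad d h) i - d (p ∷ h) i

    FracFeasible : FracStrategy → Input m → Set
    FracFeasible d []      = ⊤
    FracFeasible d (p ∷ h) =
        FracFeasible d h
      × (∀ i → 0# ≤ d (p ∷ h) i)
      × (∀ i → d (p ∷ h) i ≤ fracInject p (fracLoad d h) i)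
      × sum (d (p ∷ h)) ≤ 1#

    fracTransmitted : FracStrategy → Input m → Carrier
    fracTransmitted d []      = 0#
    fracTransmitted d (p ∷ h) = fracTransmitted d h + sum (d (p ∷ h))

    fracThroughput : FracStrategy → Input m → Carrier
    fracThroughput d σ = fracTransmitted d σ + sum (fracLoad d σ)

  record FractionalAlgorithm : Set where
    open Fractional
    field
      strategy : FracStrategy
      feasible : ∀ σ → FracFeasible strategy σ

    throughputᶠ : Input m → Carrier
    throughputᶠ = fracThroughput strategy

  -- An input with at least one packet, together with its optimum.
  record Instance : Set where
    field
      input    : Input m
      nonEmpty : 0 ℕ.< packets input
      opt      : ℕ
      isOPT    : IsOPT input opt

  ratio : (Input m → Carrier) → Instance → Carrier
  ratio T I = fromℕ opt / T input
    where open Instance I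

  -- R is the competitive ratio of an algorithm with throughput T.  The first
  -- component says that no quotient has denominator 0.
  IsCompetitiveRatio : (Input m → Carrier) → Carrier → Set
  IsCompetitiveRatio T R =
      (∀ (I : Instance) → 0# < T (Instance.input I))
    × IsSupremum (ratio T) R

{-# OPTIONS --safe #-}
module Submission where

-- FRAC sends from each buffer the probability that RAND sends from it, given
-- the same history.  As x ↦ min(B, x + p) is concave, Jensen's inequality shows
-- by induction that the loads of FRAC are at least the expected loads of RAND.
-- So FRAC is feasible, and since it transmits as much as RAND does in
-- expectation, its throughput is at least the expected throughput of RAND.

open import Defs
open import Data.Nat.Base as ℕ using (ℕ)
open import Data.Product.Base using (Σ-syntax; ∃-syntax; _×_; _,_; proj₁; proj₂)

open import Data.Empty using (⊥-elim)
open import Data.Bool.Base using (if_then_else_; true; false)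
open import Data.Fin.Base using (Fin; toℕ; zero; suc)
import Data.Fin.Properties as Fin
open import Data.List.Base using ([]; _∷_)
open import Data.Maybe.Base using (just; nothing)
import Data.Maybe.Properties as Maybe
import Data.Nat.Properties as ℕ
open import Data.Sum.Base using (_⊎_; inj₁; inj₂; [_,_]′)
open import Data.Unit.Base using (tt)
open import Data.Vec.Base as Vec using (Vec; lookup)
open import Data.Vec.Functional using (Vector)
open import Function.Base using (_∘_; const; id)
open import Level using (0ℓ)
open import Relation.Binary.Bundles using (TotalOrder)
open import Relation.Binary.PropositionalEquality.Core as ≡ using (_≡_; _≢_)
open import Relation.Nullary.Decidable.Core using (Dec; does; yes; no; _×-dec_)
open import Relation.Nullary.Decidable using (dec-true; dec-false)
open import Relation.Nullary.Negation.Core using (¬_)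
open import Relation.Unary using (Pred; Decidable; U; ∅; ∁; ⋃; _∪_; _∩_)
import Algebra.Construct.NaturalChoice.Min as Min
import Algebra.Properties.CommutativeMonoid.Sum as CommutativeMonoidSum
import Algebra.Properties.Ring as RingProperties
import Algebra.Properties.Semiring.Mult as SemiringMult
import Algebra.Properties.Semiring.Sum as SemiringSum
import Relation.Binary.Reasoning.PartialOrder as PartialOrderReasoning

module ℕΣ = CommutativeMonoidSum ℕ.+-0-commutativeMonoid

-- Ordered-field arithmetic and finite sums of reals

module RealProperties (ℝ : RealNumbers) where
  open RealNumbers ℝ hiding (zero)
  open TotalOrder totalOrder
    using (poset; total; antisym)
    renaming (refl to ≤-refl; reflexive to ≤-reflexive; trans to ≤-trans) public
  open Min totalOrder using (⊓-glb; ⊓-mono-≤) public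
  open SemiringSum semiring
    using (sum-cong-≋; ∑-comm; ∑-distrib-+; *-distribˡ-sum) public
  open SemiringMult semiring using (×-homo-+; ×-homo-1) public
  open RingProperties ring
    using (x[y-z]≈xy-xz; -‿distribʳ-*; -‿involutive; //-rightDividesˡ; //-rightDividesʳ)
  open PartialOrderReasoning poset

  +-monoˡ-≤ : ∀ x {y z} → y ≤ z → y + x ≤ z + x
  +-monoˡ-≤ x {y} {z} y≤z = begin
    y + x  ≈⟨ +-comm y x ⟩
    x + y  ≤⟨ +-monoʳ-≤ x y≤z ⟩
    x + z  ≈⟨ +-comm x z ⟩
    z + x  ∎

  +-mono-≤ : ∀ {w x y z} → w ≤ x → y ≤ z → w + y ≤ x + z
  +-mono-≤ {x = x} {y} w≤x y≤z = ≤-trans (+-monoˡ-≤ y w≤x) (+-monoʳ-≤ x y≤z)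

  x+y≤z⇒x≤z-y : ∀ {x y z} → x + y ≤ z → x ≤ z - y
  x+y≤z⇒x≤z-y {x} {y} {z} x+y≤z = begin
    x          ≈⟨ //-rightDividesʳ y x ⟨
    x + y - y  ≤⟨ +-monoˡ-≤ (- y) x+y≤z ⟩
    z - y      ∎

  x+y≤x⇒y≤0 : ∀ {x y} → x + y ≤ x → y ≤ 0#
  x+y≤x⇒y≤0 {x} {y} x+y≤x = begin
    y      ≤⟨ x+y≤z⇒x≤z-y (≤-trans (≤-reflexive (+-comm y x)) x+y≤x) ⟩
    x - x  ≈⟨ -‿inverseʳ x ⟩
    0#     ∎

  y≤z⇒0≤z-y : ∀ {y z} → y ≤ z → 0# ≤ z - y
  y≤z⇒0≤z-y {y} y≤z = x+y≤z⇒x≤z-y (≤-trans (≤-reflexive (+-identityˡ y)) y≤z)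

  *-monoʳ-≤ : ∀ {x y z} → 0# ≤ x → y ≤ z → x * y ≤ x * z
  *-monoʳ-≤ {x} {y} {z} 0≤x y≤z = begin
    x * y                    ≈⟨ +-identityˡ (x * y) ⟨
    0# + x * y               ≤⟨ +-monoˡ-≤ (x * y) (*-nonNeg 0≤x (y≤z⇒0≤z-y y≤z)) ⟩
    x * (z - y) + x * y      ≈⟨ +-congʳ (x[y-z]≈xy-xz x z y) ⟩
    x * z - x * y + x * y    ≈⟨ //-rightDividesˡ (x * y) (x * z) ⟩
    x * z                    ∎

  *-monoˡ-≤ : ∀ {x y z} → 0# ≤ x → y ≤ z → y * x ≤ z * x
  *-monoˡ-≤ {x} {y} {z} 0≤x y≤z = begin
    y * x  ≈⟨ *-comm y x ⟩
    x * y  ≤⟨ *-monoʳ-≤ 0≤x y≤z ⟩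
    x * z  ≈⟨ *-comm x z ⟩
    z * x  ∎

  x≤0⇒0≤-x : ∀ {x} → x ≤ 0# → 0# ≤ - x
  x≤0⇒0≤-x {x} x≤0 = ≤-trans (y≤z⇒0≤z-y x≤0) (≤-reflexive (+-identityˡ (- x)))

  -- By totality only `1# ≤ 0#` has to be excluded: then `- 1#` is non-negative, hence so is its
  -- square `1#`, and antisymmetry contradicts `0≉1`.
  0≤1 : 0# ≤ 1#
  0≤1 = [ id , 1≤0⇒0≤1 ]′ (total 0# 1#)
    where
    1≤0⇒0≤1 : 1# ≤ 0# → 0# ≤ 1#
    1≤0⇒0≤1 1≤0 = ⊥-elim (0≉1 (antisym 0≤1′ 1≤0))
      where
      0≤-1 = x≤0⇒0≤-x 1≤0
      0≤1′ : 0# ≤ 1#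
      0≤1′ = begin
        0#               ≤⟨ *-nonNeg 0≤-1 0≤-1 ⟩
        - 1# * - 1#      ≈⟨ -‿distribʳ-* (- 1#) 1# ⟨
        - (- 1# * 1#)    ≈⟨ -‿cong (*-identityʳ (- 1#)) ⟩
        - - 1#           ≈⟨ -‿involutive 1# ⟩
        1#               ∎

  ⁻¹-nonNeg : ∀ {x} → 0# < x → 0# ≤ x ⁻¹
  ⁻¹-nonNeg {x} (0≤x , 0≉x) = [ id , x⁻¹≤0⇒0≤x⁻¹ ]′ (total 0# (x ⁻¹))
    where
    x⁻¹≤0⇒0≤x⁻¹ : x ⁻¹ ≤ 0# → 0# ≤ x ⁻¹
    x⁻¹≤0⇒0≤x⁻¹ x⁻¹≤0 = ⊥-elim (0≉1 (antisym 0≤1 (begin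
      1#         ≈⟨ ⁻¹-inverse x (0≉x ∘ sym) ⟨
      x * x ⁻¹   ≤⟨ *-monoʳ-≤ 0≤x x⁻¹≤0 ⟩
      x * 0#     ≈⟨ zeroʳ x ⟩
      0#         ∎)))

  <-≤-trans : ∀ {x y z} → x < y → y ≤ z → x < z
  <-≤-trans (x≤y , x≉y) y≤z =
    ≤-trans x≤y y≤z ,
    λ x≈z → x≉y (antisym x≤y (≤-trans y≤z (≤-reflexive (sym x≈z))))

  -- Multiply `x ≤ y` by the non-negative numbers `x ⁻¹` and `y ⁻¹`. This turns a larger throughput
  -- into a smaller ratio.
  ⁻¹-anti-≤ : ∀ {x y} → 0# < x → x ≤ y → y ⁻¹ ≤ x ⁻¹
  ⁻¹-anti-≤ {x} {y} 0<x x≤y = begin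
    y ⁻¹               ≈⟨ *-identityʳ (y ⁻¹) ⟨
    y ⁻¹ * 1#          ≈⟨ *-congˡ (⁻¹-inverse x (proj₂ 0<x ∘ sym)) ⟨
    y ⁻¹ * (x * x ⁻¹)  ≤⟨ *-monoʳ-≤ (⁻¹-nonNeg 0<y) (*-monoˡ-≤ (⁻¹-nonNeg 0<x) x≤y) ⟩
    y ⁻¹ * (y * x ⁻¹)  ≈⟨ *-assoc (y ⁻¹) y (x ⁻¹) ⟨
    y ⁻¹ * y * x ⁻¹    ≈⟨ *-congʳ (*-comm (y ⁻¹) y) ⟩
    y * y ⁻¹ * x ⁻¹    ≈⟨ *-congʳ (⁻¹-inverse y (proj₂ 0<y ∘ sym)) ⟩
    1# * x ⁻¹          ≈⟨ *-identityˡ (x ⁻¹) ⟩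
    x ⁻¹               ∎
    where 0<y = <-≤-trans 0<x x≤y

  fromℕ-nonNeg : ∀ n → 0# ≤ fromℕ n
  fromℕ-nonNeg ℕ.zero    = ≤-refl
  fromℕ-nonNeg (ℕ.suc n) = begin
    0#            ≈⟨ +-identityˡ 0# ⟨
    0# + 0#       ≤⟨ +-mono-≤ 0≤1 (fromℕ-nonNeg n) ⟩
    1# + fromℕ n  ∎

  fromℕ-mono-≤ : ∀ {m n} → m ℕ.≤ n → fromℕ m ≤ fromℕ n
  fromℕ-mono-≤ {n = n} ℕ.z≤n = fromℕ-nonNeg n
  fromℕ-mono-≤ (ℕ.s≤s m≤n)   = +-monoʳ-≤ 1# (fromℕ-mono-≤ m≤n)

  fromℕ-+ : ∀ m n → fromℕ (m ℕ.+ n) ≈ fromℕ m + fromℕ n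
  fromℕ-+ = ×-homo-+ 1#

  sum-mono-≤ : ∀ {n} {f g : Vector Carrier n} → (∀ i → f i ≤ g i) → sum f ≤ sum g
  sum-mono-≤ {ℕ.zero}  f≤g = ≤-refl
  sum-mono-≤ {ℕ.suc n} f≤g = +-mono-≤ (f≤g zero) (sum-mono-≤ (f≤g ∘ suc))

  sum-nonNeg : ∀ {n} {f : Vector Carrier n} → (∀ i → 0# ≤ f i) → 0# ≤ sum f
  sum-nonNeg {ℕ.zero}  0≤f = ≤-refl
  sum-nonNeg {ℕ.suc n} 0≤f =
    ≤-trans (≤-reflexive (sym (+-identityˡ 0#))) (+-mono-≤ (0≤f zero) (sum-nonNeg (0≤f ∘ suc)))

  -- If the terms vanish from index `N` on, the first `N` of them bound every partial sum. This
  -- collapses the supremum in `P-⋃` to a finite sum.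
  partialSum-≤ : (g : ℕ → Carrier) → (∀ k → 0# ≤ g k) → ∀ n N →
                 (∀ {k} → N ℕ.≤ k → g k ≈ 0#) →
                 ∑[ i < n ] g (toℕ i) ≤ ∑[ i < N ] g (toℕ i)
  partialSum-≤ g 0≤g ℕ.zero    N         g≈0 = sum-nonNeg (0≤g ∘ toℕ {N})
  partialSum-≤ g 0≤g (ℕ.suc n) ℕ.zero    g≈0 = begin
    g 0 + ∑[ i < n ] g (ℕ.suc (toℕ i))
      ≤⟨ +-mono-≤ (≤-reflexive (g≈0 ℕ.z≤n))
           (partialSum-≤ (g ∘ ℕ.suc) (0≤g ∘ ℕ.suc) n 0 (λ _ → g≈0 ℕ.z≤n)) ⟩
    0# + 0#  ≈⟨ +-identityˡ 0# ⟩
    0#       ∎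
  partialSum-≤ g 0≤g (ℕ.suc n) (ℕ.suc N) g≈0 =
    +-monoʳ-≤ (g 0) (partialSum-≤ (g ∘ ℕ.suc) (0≤g ∘ ℕ.suc) n N (g≈0 ∘ ℕ.s≤s))

-- Events, bounded integer random variables and their expectations

module Probability (ℝ : RealNumbers) (S : ProbabilitySpace ℝ) where
  open RealNumbers ℝ hiding (zero)
  open RealProperties ℝ
  open ProbabilitySpace S
  open PartialOrderReasoning poset

  Event-∅ : Event ∅
  Event-∅ = Event-resp-≐ ((λ ¬U → ¬U tt) , λ ()) (Event-∁ Event-U)

  -- The countable union of the sequence A, B, B, B, ... is the binary union.
  Event-∪ : ∀ {A B} → Event A → Event B → Event (A ∪ B)
  Event-∪ {A} {B} eA eB =
    Event-resp-≐ ((λ { (0 , a) → inj₁ a ; (ℕ.suc _ , b) → inj₂ b }) ,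
                  λ { (inj₁ a) → 0 , a ; (inj₂ b) → 1 , b })
      (Event-⋃ C λ { 0 → eA ; (ℕ.suc _) → eB })
    where
    C : ℕ → Pred Ω 0ℓ
    C 0         = A
    C (ℕ.suc _) = B

  -- Decidability replaces the use of the classical De Morgan law.
  Event-∩ : ∀ {A B} → Decidable A → Decidable B → Event A → Event B → Event (A ∩ B)
  Event-∩ {A} {B} A? B? eA eB =
    Event-resp-≐ (A∩B-stable , λ { (a , b) → [ (λ ¬a → ¬a a) , (λ ¬b → ¬b b) ]′ })
      (Event-∁ (Event-∪ (Event-∁ eA) (Event-∁ eB)))
    where
    A∩B-stable : ∀ {ω} → ¬ (¬ A ω ⊎ ¬ B ω) → A ω × B ω
    A∩B-stable {ω} h with A? ω | B? ω
    ... | yes a | yes b = a , b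
    ... | no ¬a | _     = ⊥-elim (h (inj₁ ¬a))
    ... | _     | no ¬b = ⊥-elim (h (inj₂ ¬b))

  Event-const : ∀ {D : Set} → Dec D → Event (λ _ → D)
  Event-const (yes d) = Event-resp-≐ ((λ _ → d) , _) Event-U
  Event-const (no ¬d) = Event-resp-≐ ((λ ()) , ¬d) Event-∅

  Measurable : (Ω → ℕ) → Set
  Measurable X = ∀ k → Event (λ ω → X ω ≡ k)

  const-measurable : ∀ c → Measurable (const c)
  const-measurable c k = Event-const (c ℕ.≟ k)

  -- The preimage of `j` is the union, over the countably many pairs `k`, `l` with `f k l ≡ j`, of
  -- the events that `X` is `k` and `Y` is `l`. The side condition on the pair does not mention the
  -- outcome, so it enters as a constant event.
  measurable₂ : (f : ℕ → ℕ → ℕ) → ∀ {X Y} → Measurable X → Measurable Y →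
                Measurable (λ ω → f (X ω) (Y ω))
  measurable₂ f {X} {Y} mX mY j =
    Event-resp-≐ ((λ { (_ , _ , (≡.refl , ≡.refl) , e) → e }) ,
                  λ e → _ , _ , (≡.refl , ≡.refl) , e)
      (Event-⋃ _ λ k → Event-⋃ _ λ l →
        Event-∩ (λ ω → (X ω ℕ.≟ k) ×-dec (Y ω ℕ.≟ l)) (λ _ → f k l ℕ.≟ j)
          (Event-∩ (λ ω → X ω ℕ.≟ k) (λ ω → Y ω ℕ.≟ l) (mX k) (mY l))
          (Event-const (f k l ℕ.≟ j)))

  measurable₁ : (f : ℕ → ℕ) → ∀ {X} → Measurable X → Measurable (f ∘ X)
  measurable₁ f mX = measurable₂ (λ k _ → f k) mX mX

  sum-measurable : ∀ {n} {X : Fin n → Ω → ℕ} → (∀ i → Measurable (X i)) →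
                   Measurable (λ ω → ℕSum.sum (λ i → X i ω))
  sum-measurable {ℕ.zero}  mX = const-measurable 0
  sum-measurable {ℕ.suc n} mX =
    measurable₂ ℕ._+_ (mX zero) (sum-measurable (mX ∘ suc))

  -- The conditions under which the finite sum `𝔼 N X` is the true expectation of `X`.
  record RandomVariable (N : ℕ) (X : Ω → ℕ) : Set where
    constructor _,_
    field
      measurable : Measurable X
      bounded    : ∀ ω → X ω ℕ.≤ N

  open RandomVariable

  -- The constant sequence `∅` is pairwise disjoint with union `∅`, so its partial sum of two terms
  -- is at most `P ∅`.
  P-∅ : P ∅ ≈ 0#
  P-∅ = antisym (x+y≤x⇒y≤0 2P∅≤P∅) (P-nonNeg Event-∅)
    where
    2P∅≤P∅ : P ∅ + P ∅ ≤ P ∅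
    2P∅≤P∅ = begin
      P ∅ + P ∅         ≈⟨ +-congˡ (+-identityʳ (P ∅)) ⟨
      P ∅ + (P ∅ + 0#)  ≤⟨ proj₁ (P-⋃ (const ∅) (const Event-∅) (λ _ ())) 2 ⟩
      P (⋃ ℕ (const ∅)) ≈⟨ P-resp-≐ Event-∅ ((λ ()) , λ ()) ⟨
      P ∅               ∎

  P-empty : ∀ {A} → (∀ {ω} → ¬ A ω) → P A ≈ 0#
  P-empty ¬A = trans (sym (P-resp-≐ Event-∅ ((λ ()) , ¬A))) P-∅

  -- Bundles the decision procedure that `Event-∩` asks for, so that intersections can be iterated.
  record DecidableEvent (A : Pred Ω 0ℓ) : Set where
    constructor _,_
    field
      event : Event A
      dec   : Decidable A

  open DecidableEvent

  sure : DecidableEvent U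
  sure = Event-U , λ _ → yes tt

  infixr 7 _∩ᴱ_
  _∩ᴱ_ : ∀ {A B} → DecidableEvent A → DecidableEvent B → DecidableEvent (A ∩ B)
  (eA , A?) ∩ᴱ (eB , B?) = Event-∩ A? B? eA eB , λ ω → A? ω ×-dec B? ω

  value : ∀ {X} → Measurable X → ∀ k → DecidableEvent (λ ω → X ω ≡ k)
  value {X} mX k = mX k , λ ω → X ω ℕ.≟ k

  -- Countable additivity over the values of `X`; the pieces for values above `N` are empty.
  P-partition : ∀ {A N X} → DecidableEvent A → RandomVariable N X →
                P A ≈ ∑[ k ≤ N ] P (A ∩ λ ω → X ω ≡ toℕ k)
  P-partition {A} {N} {X} dA rX = begin-equality
    P A
      ≈⟨ P-resp-≐ (event dA) ((λ a → _ , a , ≡.refl) , λ { (_ , a , _) → a }) ⟩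
    P (⋃ ℕ Aₖ)
      -- The finite sum bounds all partial sums, so the supremum is at most it. Conversely it is
      -- itself the partial sum of length `ℕ.suc N`, for the values 0 to `N`.
      ≈⟨ antisym
           (proj₂ supremum _ λ n → partialSum-≤ _ (λ k → P-nonNeg (eAₖ k)) n (ℕ.suc N) vanish)
           (proj₁ supremum (ℕ.suc N)) ⟩
    ∑[ k ≤ N ] P (Aₖ (toℕ k)) ∎
    where
    Aₖ : ℕ → Pred Ω 0ℓ
    Aₖ k = A ∩ λ ω → X ω ≡ k

    eAₖ : ∀ k → Event (Aₖ k)
    eAₖ k = event (dA ∩ᴱ value (measurable rX) k)

    supremum : IsSupremum (λ n → ∑[ i < n ] P (Aₖ (toℕ i))) (P (⋃ ℕ Aₖ))
    supremum = P-⋃ Aₖ eAₖ λ i≢j → λ { ((_ , ≡.refl) , (_ , ≡.refl)) → i≢j ≡.refl }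

    vanish : ∀ {k} → N ℕ.< k → P (Aₖ k) ≈ 0#
    vanish N<k = P-empty λ { {ω} (_ , ≡.refl) → ℕ.<⇒≱ N<k (bounded rX ω) }

  -- The expectation of `X` times the indicator of `A`.
  𝔼-on : Pred Ω 0ℓ → (N : ℕ) → (Ω → ℕ) → Carrier
  𝔼-on A N X = ∑[ k ≤ N ] (fromℕ (toℕ k) * P (A ∩ λ ω → X ω ≡ toℕ k))

  𝔼-on-U : ∀ {N X} → RandomVariable N X → 𝔼 N X ≈ 𝔼-on U N X
  𝔼-on-U {N} rX = sum-cong-≋ {ℕ.suc N} λ k →
    *-congˡ {fromℕ (toℕ k)} (P-resp-≐ (measurable rX (toℕ k)) ((λ e → tt , e) , proj₂))

  -- Each probability in the sum is split by the value of `Y`; then the two sums are exchanged.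
  𝔼-on-partition : ∀ {A N M X Y} → DecidableEvent A →
                   RandomVariable N X → RandomVariable M Y →
                   𝔼-on A N X ≈ ∑[ l ≤ M ] 𝔼-on (A ∩ λ ω → Y ω ≡ toℕ l) N X
  𝔼-on-partition {A} {N} {M} {X} {Y} dA rX rY = begin-equality
    ∑[ k ≤ N ] (fromℕ (toℕ k) * P (A ∩ X≡ k))
      ≈⟨ sum-cong-≋ {ℕ.suc N} (λ k → *-congˡ {fromℕ (toℕ k)} (P-partition (dA ∩ᴱ X≡ᴱ k) rY)) ⟩
    ∑[ k ≤ N ] (fromℕ (toℕ k) * ∑[ l ≤ M ] P ((A ∩ X≡ k) ∩ Y≡ l))
      ≈⟨ sum-cong-≋ {ℕ.suc N} (λ k → *-distribˡ-sum (fromℕ (toℕ k)) (λ l → P ((A ∩ X≡ k) ∩ Y≡ l))) ⟩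
    ∑[ k ≤ N ] ∑[ l ≤ M ] (fromℕ (toℕ k) * P ((A ∩ X≡ k) ∩ Y≡ l))
      ≈⟨ ∑-comm (λ k l → fromℕ (toℕ k) * P ((A ∩ X≡ k) ∩ Y≡ l)) ⟩
    ∑[ l ≤ M ] ∑[ k ≤ N ] (fromℕ (toℕ k) * P ((A ∩ X≡ k) ∩ Y≡ l))
      ≈⟨ sum-cong-≋ {ℕ.suc M} (λ l → sum-cong-≋ {ℕ.suc N} λ k → *-congˡ {fromℕ (toℕ k)}
           (P-resp-≐ {B = (A ∩ Y≡ l) ∩ X≡ k} (event ((dA ∩ᴱ X≡ᴱ k) ∩ᴱ Y≡ᴱ l))
             ((λ { ((a , x) , y) → (a , y) , x }) , λ { ((a , y) , x) → (a , x) , y }))) ⟩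
    ∑[ l ≤ M ] 𝔼-on (A ∩ Y≡ l) N X ∎
    where
    X≡ : Fin (ℕ.suc N) → Pred Ω 0ℓ
    X≡ k ω = X ω ≡ toℕ k
    Y≡ : Fin (ℕ.suc M) → Pred Ω 0ℓ
    Y≡ l ω = Y ω ≡ toℕ l
    X≡ᴱ : ∀ k → DecidableEvent (X≡ k)
    X≡ᴱ k = value (measurable rX) (toℕ k)
    Y≡ᴱ : ∀ l → DecidableEvent (Y≡ l)
    Y≡ᴱ l = value (measurable rY) (toℕ l)

  𝔼-on-const : ∀ {A N X} → DecidableEvent A → RandomVariable N X →
               ∀ c → (∀ {ω} → A ω → X ω ≡ c) → 𝔼-on A N X ≈ fromℕ c * P A
  𝔼-on-const {A} {N} {X} dA rX c X≡c = begin-equality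
    ∑[ k ≤ N ] (fromℕ (toℕ k) * P (A ∩ X≡ k))  ≈⟨ sum-cong-≋ term ⟩
    ∑[ k ≤ N ] (fromℕ c * P (A ∩ X≡ k))        ≈⟨ *-distribˡ-sum (fromℕ c) (λ k → P (A ∩ X≡ k)) ⟨
    fromℕ c * ∑[ k ≤ N ] P (A ∩ X≡ k)          ≈⟨ *-congˡ (P-partition dA rX) ⟨
    fromℕ c * P A                              ∎
    where
    X≡ : Fin (ℕ.suc N) → Pred Ω 0ℓ
    X≡ k ω = X ω ≡ toℕ k

    term : ∀ k → fromℕ (toℕ k) * P (A ∩ X≡ k) ≈ fromℕ c * P (A ∩ X≡ k)
    term k with toℕ k ℕ.≟ c
    ... | yes k≡c = *-congʳ (reflexive (≡.cong fromℕ k≡c))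
    -- `X` is `c` on `A`, so this piece is empty and its coefficient may be changed to `c`.
    ... | no  k≢c = begin-equality
      fromℕ (toℕ k) * P (A ∩ X≡ k)  ≈⟨ *-congˡ P≈0 ⟩
      fromℕ (toℕ k) * 0#            ≈⟨ zeroʳ _ ⟩
      0#                            ≈⟨ zeroʳ _ ⟨
      fromℕ c * 0#                  ≈⟨ *-congˡ P≈0 ⟨
      fromℕ c * P (A ∩ X≡ k)        ∎
      where
      P≈0 : P (A ∩ X≡ k) ≈ 0#
      P≈0 = P-empty λ { (a , x) → k≢c (≡.trans (≡.sym x) (X≡c a)) }

  𝔼-const : ∀ {N c} → c ℕ.≤ N → 𝔼 N (const c) ≈ fromℕ c
  𝔼-const {N} {c} c≤N = begin-equality
    𝔼 N (const c)       ≈⟨ 𝔼-on-U rv ⟩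
    𝔼-on U N (const c)  ≈⟨ 𝔼-on-const sure rv c (λ _ → ≡.refl) ⟩
    fromℕ c * P U       ≈⟨ *-congˡ P-U ⟩
    fromℕ c * 1#        ≈⟨ *-identityʳ (fromℕ c) ⟩
    fromℕ c             ∎
    where
    rv : RandomVariable N (const c)
    rv = const-measurable c , λ _ → c≤N

  module _ {N M X Y} (rX : RandomVariable N X) (rY : RandomVariable M Y) where

    private
      -- The nesting and the leading `U` match what two uses of `𝔼-on-partition` produce from
      -- `𝔼-on U`.
      joint : Fin (ℕ.suc N) → Fin (ℕ.suc M) → Pred Ω 0ℓ
      joint k l = (U ∩ λ ω → X ω ≡ toℕ k) ∩ λ ω → Y ω ≡ toℕ l

      joint-event : ∀ k l → DecidableEvent (joint k l)
      joint-event k l =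
        (sure ∩ᴱ value (measurable rX) (toℕ k)) ∩ᴱ value (measurable rY) (toℕ l)

    -- On each cell of the partition by `X` and `Y` the variable is constant. Expectations with
    -- different bounds thus become double sums over the same cells, comparable term by term.
    𝔼-joint : ∀ {K} (f : ℕ → ℕ → ℕ) → (∀ ω → f (X ω) (Y ω) ℕ.≤ K) →
              𝔼 K (λ ω → f (X ω) (Y ω)) ≈
              ∑[ k ≤ N ] ∑[ l ≤ M ] (fromℕ (f (toℕ k) (toℕ l)) * P (joint k l))
    𝔼-joint {K} f f≤K = begin-equality
      𝔼 K W
        ≈⟨ 𝔼-on-U rW ⟩
      𝔼-on U K W
        ≈⟨ 𝔼-on-partition sure rW rX ⟩
      ∑[ k ≤ N ] 𝔼-on (U ∩ λ ω → X ω ≡ toℕ k) K W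
        ≈⟨ sum-cong-≋ {ℕ.suc N} (λ k →
             𝔼-on-partition (sure ∩ᴱ value (measurable rX) (toℕ k)) rW rY) ⟩
      ∑[ k ≤ N ] ∑[ l ≤ M ] 𝔼-on (joint k l) K W
        ≈⟨ sum-cong-≋ {ℕ.suc N} (λ k → sum-cong-≋ {ℕ.suc M} λ l →
             𝔼-on-const (joint-event k l) rW (f (toℕ k) (toℕ l)) λ { ((_ , x) , y) → ≡.cong₂ f x y }) ⟩
      ∑[ k ≤ N ] ∑[ l ≤ M ] (fromℕ (f (toℕ k) (toℕ l)) * P (joint k l)) ∎
      where
      W : Ω → ℕ
      W ω = f (X ω) (Y ω)
      rW : RandomVariable K W
      rW = measurable₂ f (measurable rX) (measurable rY) , f≤K

    𝔼-mono : (∀ ω → X ω ℕ.≤ Y ω) → 𝔼 N X ≤ 𝔼 M Y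
    𝔼-mono X≤Y = begin
      𝔼 N X  ≈⟨ 𝔼-joint (λ k l → k) (bounded rX) ⟩
      _      ≤⟨ sum-mono-≤ (λ k → sum-mono-≤ (λ l → term k l)) ⟩
      _      ≈⟨ 𝔼-joint (λ k l → l) (bounded rY) ⟨
      𝔼 M Y  ∎
      where
      term : ∀ k l → fromℕ (toℕ k) * P (joint k l) ≤ fromℕ (toℕ l) * P (joint k l)
      term k l with toℕ k ℕ.≤? toℕ l
      ... | yes k≤l = *-monoˡ-≤ (P-nonNeg (event (joint-event k l))) (fromℕ-mono-≤ k≤l)
      -- A cell with `k` above `l` is empty because `X` never exceeds `Y`.
      ... | no  k≰l = begin
        fromℕ (toℕ k) * P (joint k l)  ≈⟨ *-congˡ P≈0 ⟩
        fromℕ (toℕ k) * 0#             ≈⟨ zeroʳ _ ⟩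
        0#                             ≈⟨ zeroʳ _ ⟨
        fromℕ (toℕ l) * 0#             ≈⟨ *-congˡ P≈0 ⟨
        fromℕ (toℕ l) * P (joint k l)  ∎
        where
        P≈0 : P (joint k l) ≈ 0#
        P≈0 = P-empty λ { {ω} ((_ , x) , y) → k≰l (≡.subst₂ ℕ._≤_ x y (X≤Y ω)) }

    𝔼-+ : ∀ {K} → (∀ ω → X ω ℕ.+ Y ω ℕ.≤ K) →
          𝔼 K (λ ω → X ω ℕ.+ Y ω) ≈ 𝔼 N X + 𝔼 M Y
    𝔼-+ {K} X+Y≤K = begin-equality
      𝔼 K (λ ω → X ω ℕ.+ Y ω)
        ≈⟨ 𝔼-joint ℕ._+_ X+Y≤K ⟩
      ∑[ k ≤ N ] ∑[ l ≤ M ] (fromℕ (toℕ k ℕ.+ toℕ l) * P (joint k l))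
        ≈⟨ sum-cong-≋ {ℕ.suc N} (λ k → sum-cong-≋ {ℕ.suc M} (λ l →
             trans (*-congʳ (fromℕ-+ (toℕ k) (toℕ l))) (distribʳ (P (joint k l)) _ _))) ⟩
      ∑[ k ≤ N ] ∑[ l ≤ M ] (xP k l + yP k l)
        ≈⟨ sum-cong-≋ {ℕ.suc N} (λ k → ∑-distrib-+ (xP k) (yP k)) ⟩
      ∑[ k ≤ N ] (∑[ l ≤ M ] xP k l + ∑[ l ≤ M ] yP k l)
        ≈⟨ ∑-distrib-+ (sum ∘ xP) (sum ∘ yP) ⟩
      ∑[ k ≤ N ] ∑[ l ≤ M ] xP k l + ∑[ k ≤ N ] ∑[ l ≤ M ] yP k l
        ≈⟨ +-cong (𝔼-joint (λ k l → k) (bounded rX)) (𝔼-joint (λ k l → l) (bounded rY)) ⟨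
      𝔼 N X + 𝔼 M Y ∎
      where
      xP yP : Fin (ℕ.suc N) → Fin (ℕ.suc M) → Carrier
      xP k l = fromℕ (toℕ k) * P (joint k l)
      yP k l = fromℕ (toℕ l) * P (joint k l)

  𝔼-nonNeg : ∀ {N X} → RandomVariable N X → 0# ≤ 𝔼 N X
  𝔼-nonNeg {N} rX = sum-nonNeg {ℕ.suc N} λ k →
    *-nonNeg (fromℕ-nonNeg (toℕ k)) (P-nonNeg (measurable rX (toℕ k)))

  𝔼-≤ : ∀ {N X} → RandomVariable N X → 𝔼 N X ≤ fromℕ N
  𝔼-≤ {N} {X} rX = begin
    𝔼 N X          ≤⟨ 𝔼-mono rX (const-measurable N , λ _ → ℕ.≤-refl) (bounded rX) ⟩
    𝔼 N (const N)  ≈⟨ 𝔼-const ℕ.≤-refl ⟩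
    fromℕ N        ∎

  -- The bound `K` on the total is separate from the bound `N` on the summands: at most one packet
  -- is sent in a step over all buffers, and the loads together are at most the number of injected
  -- packets.
  𝔼-sum : ∀ {n N K} {X : Fin n → Ω → ℕ} → (∀ i → RandomVariable N (X i)) →
          (∀ ω → ℕSum.sum (λ i → X i ω) ℕ.≤ K) →
          𝔼 K (λ ω → ℕSum.sum (λ i → X i ω)) ≈ ∑[ i < n ] 𝔼 N (X i)
  𝔼-sum {ℕ.zero} {K = K}      rX ∑≤K = 𝔼-const {K} {0} ℕ.z≤n
  𝔼-sum {ℕ.suc n} {N} {K} {X} rX ∑≤K =
    trans (𝔼-+ (rX zero) (sum-measurable (measurable ∘ rX ∘ suc) , tail≤K) ∑≤K)
      (+-congˡ (𝔼-sum (rX ∘ suc) tail≤K))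
    where
    tail≤K : ∀ ω → ℕSum.sum (λ i → X (suc i) ω) ℕ.≤ K
    tail≤K ω = ℕ.≤-trans (ℕ.m≤n+m _ (X zero ω)) (∑≤K ω)

-- Finite sums of natural numbers

ℕsum-mono-≤ : ∀ {n} {f g : Vector ℕ n} → (∀ i → f i ℕ.≤ g i) → ℕSum.sum f ℕ.≤ ℕSum.sum g
ℕsum-mono-≤ {ℕ.zero}  f≤g = ℕ.z≤n
ℕsum-mono-≤ {ℕ.suc n} f≤g = ℕ.+-mono-≤ (f≤g zero) (ℕsum-mono-≤ (f≤g ∘ suc))

sum-lookup : ∀ {n} (p : Vec ℕ n) → ℕSum.sum (lookup p) ≡ Vec.sum p
sum-lookup Vec.[]      = ≡.refl
sum-lookup (x Vec.∷ p) = ≡.cong (x ℕ.+_) (sum-lookup p)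

sum-indicator : ∀ {n} (j : Fin n) → ℕSum.sum (λ i → if does (i Fin.≟ j) then 1 else 0) ≡ 1
sum-indicator {ℕ.suc n} zero    = ≡.cong ℕ.suc (ℕSum.sum-replicate-zero n)
sum-indicator {ℕ.suc n} (suc j) = sum-indicator j

-- Packet accounting in the integral model

module IntegralProperties (B m : ℕ) where
  open Integral B m
  open ℕ.≤-Reasoning

  sent-hit : ∀ i → sent (just i) i ≡ 1
  sent-hit i rewrite dec-true (i Fin.≟ i) ≡.refl = ≡.refl

  sent-miss : ∀ {a i} → a ≢ just i → sent a i ≡ 0
  sent-miss {nothing} {i} _ = ≡.refl
  sent-miss {just j}  {i} j≢i
    rewrite dec-false (i Fin.≟ j) (j≢i ∘ ≡.cong just ∘ ≡.sym) = ≡.refl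

  sent-≤1 : ∀ a i → sent a i ℕ.≤ 1
  sent-≤1 nothing  i = ℕ.z≤n
  sent-≤1 (just j) i with does (i Fin.≟ j)
  ... | true  = ℕ.≤-refl
  ... | false = ℕ.z≤n

  sum-sent-≤1 : ∀ a → ℕSum.sum (sent a) ℕ.≤ 1
  sum-sent-≤1 nothing  = ℕ.≤-trans (ℕ.≤-reflexive (ℕSum.sum-replicate-zero m)) ℕ.z≤n
  sum-sent-≤1 (just j) = ℕ.≤-reflexive (sum-indicator j)

  load-≤B : ∀ d σ i → load d σ i ℕ.≤ B
  load-≤B d []      i = ℕ.z≤n
  load-≤B d (p ∷ h) i = ℕ.≤-trans (ℕ.m∸n≤m _ (sent (d (p ∷ h)) i)) (ℕ.m⊓n≤m B _)

  -- Feasibility makes the truncated subtraction in `load` exact.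
  load+sent : ∀ d p h → Feasible d (p ∷ h) → ∀ i →
              load d (p ∷ h) i ℕ.+ sent (d (p ∷ h)) i ≡ inject p (load d h) i
  load+sent d p h (_ , s≤x) i = ℕ.m∸n+n≡m (s≤x i)

  -- A packet present after the last injection counts whether it is sent in the next step or left in
  -- its buffer, so the last action does not affect the throughput.
  throughput-∷ : ∀ d p h → Feasible d (p ∷ h) →
                 throughput d (p ∷ h) ≡ transmitted d h ℕ.+ ℕSum.sum (inject p (load d h))
  throughput-∷ d p h feas = begin-equality
    (T ℕ.+ ℕSum.sum s) ℕ.+ ℕSum.sum l  ≡⟨ ℕ.+-assoc T (ℕSum.sum s) (ℕSum.sum l) ⟩
    T ℕ.+ (ℕSum.sum s ℕ.+ ℕSum.sum l)  ≡⟨ ≡.cong (T ℕ.+_) (ℕ.+-comm (ℕSum.sum s) (ℕSum.sum l)) ⟩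
    T ℕ.+ (ℕSum.sum l ℕ.+ ℕSum.sum s)  ≡⟨ ≡.cong (T ℕ.+_) (ℕΣ.∑-distrib-+ l s) ⟨
    T ℕ.+ ℕSum.sum (λ i → l i ℕ.+ s i) ≡⟨ ≡.cong (T ℕ.+_) (ℕSum.sum-cong-≗ (load+sent d p h feas)) ⟩
    T ℕ.+ ℕSum.sum (inject p (load d h)) ∎
    where
    T = transmitted d h
    s = sent (d (p ∷ h))
    l = load d (p ∷ h)

  -- Ensures that `expectedThroughput`, which sums over the values up to `packets σ`, misses no
  -- value.
  throughput-≤-packets : ∀ d σ → Feasible d σ → throughput d σ ℕ.≤ packets σ
  throughput-≤-packets d []      _    = ℕ.≤-reflexive (ℕSum.sum-replicate-zero m)
  throughput-≤-packets d (p ∷ h) feas = begin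
    throughput d (p ∷ h)
      ≡⟨ throughput-∷ d p h feas ⟩
    T ℕ.+ ℕSum.sum (inject p x)
      ≤⟨ ℕ.+-monoʳ-≤ T (ℕsum-mono-≤ λ i → ℕ.m⊓n≤n B (x i ℕ.+ lookup p i)) ⟩
    T ℕ.+ ℕSum.sum (λ i → x i ℕ.+ lookup p i)
      ≡⟨ ≡.cong (T ℕ.+_) (ℕΣ.∑-distrib-+ x (lookup p)) ⟩
    T ℕ.+ (ℕSum.sum x ℕ.+ ℕSum.sum (lookup p))
      ≡⟨ ℕ.+-assoc T (ℕSum.sum x) _ ⟨
    throughput d h ℕ.+ ℕSum.sum (lookup p)
      ≡⟨ ≡.cong (throughput d h ℕ.+_) (sum-lookup p) ⟩
    throughput d h ℕ.+ Vec.sum p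
      ≤⟨ ℕ.+-monoˡ-≤ (Vec.sum p) (throughput-≤-packets d h (proj₁ feas)) ⟩
    packets h ℕ.+ Vec.sum p
      ≡⟨ ℕ.+-comm (packets h) (Vec.sum p) ⟩
    packets (p ∷ h) ∎
    where
    T = transmitted d h
    x = load d h

  -- After a single injection all feasible schedules have the same throughput by `throughput-∷`, so
  -- idling is optimal. This provides an explicit instance with a known optimum.
  isOPT-singleton : ∀ p → IsOPT (p ∷ []) (ℕSum.sum (inject p (const 0)))
  isOPT-singleton p =
    (const nothing , idle , throughput-∷ (offline (const nothing)) p [] idle) ,
    λ s feas → ℕ.≤-reflexive (throughput-∷ (offline s) p [] feas)
    where
    idle : Feasible (offline (const nothing)) (p ∷ [])
    idle = tt , λ _ → ℕ.z≤n

-- The fractional algorithm and its comparison with the randomized one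

module Derandomization (ℝ : RealNumbers) (B m : ℕ) (RAND : RandomizedAlgorithm ℝ B m) where
  open RealNumbers ℝ hiding (zero)
  open RealProperties ℝ
  open RandomizedAlgorithm RAND
  open Probability ℝ space
  open RandomVariable using (bounded) renaming (measurable to rv-measurable)
  open Integral B m
  open IntegralProperties B m
  open Fractional ℝ B m
  open PartialOrderReasoning poset

  sentᴿ injectᴿ loadᴿ : Input m → Fin m → Ω → ℕ
  sentᴿ   σ i ω = sent (strategy ω σ) i
  loadᴿ   σ i ω = load (strategy ω) σ i
  -- A default value: nothing has been injected yet.
  injectᴿ []      i ω = 0
  injectᴿ (p ∷ h) i ω = inject p (load (strategy ω) h) i

  -- The value is 1 exactly when the action is `just i`, an event by `measurable`, and 0 on the
  -- complement.
  sentᴿ-rv : ∀ σ i → RandomVariable 1 (sentᴿ σ i)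
  sentᴿ-rv σ i = meas , λ ω → sent-≤1 (strategy ω σ) i
    where
    miss : ∀ {a} → sent a i ≡ 0 → a ≢ just i
    miss s≡0 ≡.refl with () ← ≡.trans (≡.sym (sent-hit i)) s≡0

    hit : ∀ {a} → sent a i ≡ 1 → a ≡ just i
    hit {a} s≡1 with Maybe.≡-dec Fin._≟_ a (just i)
    ... | yes a≡i = a≡i
    ... | no  a≢i with () ← ≡.trans (≡.sym (sent-miss a≢i)) s≡1

    meas : Measurable (sentᴿ σ i)
    meas 0 = Event-resp-≐ (sent-miss , miss) (Event-∁ (measurable σ (just i)))
    meas 1 = Event-resp-≐ ((λ a≡i → ≡.trans (≡.cong (λ a → sent a i) a≡i) (sent-hit i)) , hit)
      (measurable σ (just i))
    meas (ℕ.suc (ℕ.suc k)) = Event-resp-≐ ((λ ()) , λ {ω} s≡k →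
        ℕ.<⇒≱ (ℕ.s≤s (ℕ.s≤s ℕ.z≤n)) (≡.subst (ℕ._≤ 1) s≡k (sent-≤1 (strategy ω σ) i))) Event-∅

  sum-sentᴿ-rv : ∀ σ → RandomVariable 1 (λ ω → ℕSum.sum (sent (strategy ω σ)))
  sum-sentᴿ-rv σ =
    sum-measurable (rv-measurable ∘ sentᴿ-rv σ) , λ ω → sum-sent-≤1 (strategy ω σ)

  loadᴿ-rv : ∀ σ i → RandomVariable B (loadᴿ σ i)
  injectᴿ-rv : ∀ σ i → RandomVariable B (injectᴿ σ i)

  loadᴿ-rv []      i = const-measurable 0 , λ _ → ℕ.z≤n
  loadᴿ-rv (p ∷ h) i =
    measurable₂ ℕ._∸_ (rv-measurable (injectᴿ-rv (p ∷ h) i)) (rv-measurable (sentᴿ-rv (p ∷ h) i)) ,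
    λ ω → load-≤B (strategy ω) (p ∷ h) i

  injectᴿ-rv []      i = const-measurable 0 , λ _ → ℕ.z≤n
  injectᴿ-rv (p ∷ h) i =
    measurable₁ (λ x → B ℕ.⊓ (x ℕ.+ lookup p i)) (rv-measurable (loadᴿ-rv h i)) ,
    λ ω → ℕ.m⊓n≤m B _

  frac : FracStrategy
  frac σ i = 𝔼 1 (sentᴿ σ i)

  -- Both sides lose the same amount `𝔼 1 (sentᴿ σ i)` in a step, so the inequality after the
  -- injection survives the transmission.
  𝔼-load-≤ : ∀ σ i → 𝔼 B (loadᴿ σ i) ≤ fracLoad frac σ i
  -- Jensen's inequality for a minimum: the expectation of a minimum is at most the expectation of
  -- either argument.
  𝔼-inject-≤ : ∀ p h i → 𝔼 B (injectᴿ (p ∷ h) i) ≤ fracInject p (fracLoad frac h) i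

  𝔼-load-≤ []      i = ≤-reflexive (𝔼-const {B} {0} ℕ.z≤n)
  𝔼-load-≤ (p ∷ h) i = x+y≤z⇒x≤z-y (begin
    𝔼 B (loadᴿ σ i) + 𝔼 1 (sentᴿ σ i)        ≈⟨ 𝔼-+ (loadᴿ-rv σ i) (sentᴿ-rv σ i) load+sent-≤B ⟨
    -- `split` is a pointwise equality, and `𝔼-mono` transports it to expectations.
    𝔼 B (λ ω → loadᴿ σ i ω ℕ.+ sentᴿ σ i ω)  ≤⟨ 𝔼-mono load+sent-rv (injectᴿ-rv σ i) (ℕ.≤-reflexive ∘ split) ⟩
    𝔼 B (injectᴿ σ i)                        ≤⟨ 𝔼-inject-≤ p h i ⟩
    fracInject p (fracLoad frac h) i         ∎)
    where
    σ = p ∷ h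
    split : ∀ ω → loadᴿ σ i ω ℕ.+ sentᴿ σ i ω ≡ injectᴿ σ i ω
    split ω = load+sent (strategy ω) p h (feasible ω σ) i
    load+sent-≤B : ∀ ω → loadᴿ σ i ω ℕ.+ sentᴿ σ i ω ℕ.≤ B
    load+sent-≤B ω = ℕ.≤-trans (ℕ.≤-reflexive (split ω)) (ℕ.m⊓n≤m B _)
    load+sent-rv : RandomVariable B (λ ω → loadᴿ σ i ω ℕ.+ sentᴿ σ i ω)
    load+sent-rv =
      measurable₂ ℕ._+_ (rv-measurable (loadᴿ-rv σ i)) (rv-measurable (sentᴿ-rv σ i)) , load+sent-≤B

  𝔼-inject-≤ p h i = begin
    𝔼 B (injectᴿ (p ∷ h) i)
      ≤⟨ ⊓-glb (𝔼-≤ (injectᴿ-rv (p ∷ h) i)) (begin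
           𝔼 B (injectᴿ (p ∷ h) i)                     ≤⟨ 𝔼-mono (injectᴿ-rv (p ∷ h) i) load+p-rv (λ ω → ℕ.m⊓n≤n B _) ⟩
           𝔼 (B ℕ.+ q) (λ ω → loadᴿ h i ω ℕ.+ q)       ≈⟨ 𝔼-+ (loadᴿ-rv h i) q-rv (bounded load+p-rv) ⟩
           𝔼 B (loadᴿ h i) + 𝔼 q (const q)             ≈⟨ +-congˡ (𝔼-const ℕ.≤-refl) ⟩
           𝔼 B (loadᴿ h i) + fromℕ q                   ∎) ⟩
    fromℕ B ⊓ (𝔼 B (loadᴿ h i) + fromℕ q)
      ≤⟨ ⊓-mono-≤ (≤-refl {fromℕ B}) (+-monoˡ-≤ (fromℕ q) (𝔼-load-≤ h i)) ⟩
    fracInject p (fracLoad frac h) i ∎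
    where
    q = lookup p i
    q-rv : RandomVariable q (const q)
    q-rv = const-measurable q , λ _ → ℕ.≤-refl
    load+p-rv : RandomVariable (B ℕ.+ q) (λ ω → loadᴿ h i ω ℕ.+ q)
    load+p-rv = measurable₁ (ℕ._+ q) (rv-measurable (loadᴿ-rv h i)) ,
      λ ω → ℕ.+-monoˡ-≤ q (load-≤B (strategy ω) h i)

  frac-feasible : ∀ σ → FracFeasible frac σ
  frac-feasible []      = tt
  frac-feasible (p ∷ h) =
    frac-feasible h ,
    (λ i → 𝔼-nonNeg (sentᴿ-rv σ i)) ,
    -- For every outcome the amount sent is at most the load after the injection; take expectations
    -- and compare the loads.
    (λ i → ≤-trans (𝔼-mono (sentᴿ-rv σ i) (injectᴿ-rv σ i) λ ω → proj₂ (feasible ω σ) i)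
                   (𝔼-inject-≤ p h i)) ,
    (begin
      sum (frac σ)                                ≈⟨ 𝔼-sum (sentᴿ-rv σ) (bounded (sum-sentᴿ-rv σ)) ⟨
      𝔼 1 (λ ω → ℕSum.sum (sent (strategy ω σ)))  ≤⟨ 𝔼-≤ (sum-sentᴿ-rv σ) ⟩
      fromℕ 1                                     ≈⟨ ×-homo-1 1# ⟩
      1#                                          ∎)
    where σ = p ∷ h

  transmittedᴿ : Input m → Ω → ℕ
  transmittedᴿ σ ω = transmitted (strategy ω) σ

  transmittedᴿ-measurable : ∀ σ → Measurable (transmittedᴿ σ)
  transmittedᴿ-measurable []      = const-measurable 0
  transmittedᴿ-measurable (p ∷ h) =
    measurable₂ ℕ._+_ (transmittedᴿ-measurable h) (rv-measurable (sum-sentᴿ-rv (p ∷ h)))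

  -- An arbitrary bound `N` lets the induction keep the same range for all shorter histories.
  𝔼-transmitted : ∀ {N} σ → (∀ ω → transmittedᴿ σ ω ℕ.≤ N) →
                  𝔼 N (transmittedᴿ σ) ≈ fracTransmitted frac σ
  𝔼-transmitted {N} []      T≤N = 𝔼-const {N} {0} ℕ.z≤n
  𝔼-transmitted {N} (p ∷ h) T≤N = begin-equality
    𝔼 N (transmittedᴿ σ)
      ≈⟨ 𝔼-+ (transmittedᴿ-measurable h , T′≤N)
             (sum-sentᴿ-rv σ) T≤N ⟩
    𝔼 N (transmittedᴿ h) + 𝔼 1 (λ ω → ℕSum.sum (sent (strategy ω σ)))
      ≈⟨ +-cong (𝔼-transmitted h T′≤N) (𝔼-sum (sentᴿ-rv σ) (bounded (sum-sentᴿ-rv σ))) ⟩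
    fracTransmitted frac σ ∎
    where
    σ = p ∷ h
    T′≤N : ∀ ω → transmittedᴿ h ω ℕ.≤ N
    T′≤N ω = ℕ.≤-trans (ℕ.m≤m+n _ _) (T≤N ω)

  -- The transmitted amounts agree in expectation, so any gain comes from the larger loads left at
  -- the end.
  expectedThroughput-≤ : ∀ σ → expectedThroughput σ ≤ fracThroughput frac σ
  expectedThroughput-≤ σ = begin
    expectedThroughput σ
      ≈⟨ 𝔼-+ (transmittedᴿ-measurable σ , T≤N) (sum-measurable (rv-measurable ∘ loadᴿ-rv σ) , L≤N) T+L≤N ⟩
    𝔼 N (transmittedᴿ σ) + 𝔼 N (λ ω → ℕSum.sum (load (strategy ω) σ))
      ≈⟨ +-cong (𝔼-transmitted σ T≤N) (𝔼-sum (loadᴿ-rv σ) L≤N) ⟩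
    fracTransmitted frac σ + ∑[ i < m ] 𝔼 B (loadᴿ σ i)
      ≤⟨ +-monoʳ-≤ _ (sum-mono-≤ (𝔼-load-≤ σ)) ⟩
    fracThroughput frac σ ∎
    where
    N = packets σ
    T+L≤N : ∀ ω → throughput (strategy ω) σ ℕ.≤ N
    T+L≤N ω = throughput-≤-packets (strategy ω) σ (feasible ω σ)
    T≤N : ∀ ω → transmittedᴿ σ ω ℕ.≤ N
    T≤N ω = ℕ.≤-trans (ℕ.m≤m+n _ _) (T+L≤N ω)
    L≤N : ∀ ω → ℕSum.sum (load (strategy ω) σ) ℕ.≤ N
    L≤N ω = ℕ.≤-trans (ℕ.m≤n+m _ (transmittedᴿ σ ω)) (T+L≤N ω)

  FRAC : FractionalAlgorithm ℝ B m
  FRAC = record { strategy = frac ; feasible = frac-feasible }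

-- From throughputs to competitive ratios

competitiveRatio-antitone :
  (ℝ : RealNumbers) (let open RealNumbers ℝ) (B m : ℕ) → 1 ℕ.≤ m →
  (T T′ : Input m → Carrier) → (∀ σ → T σ ≤ T′ σ) →
  ∀ {R} → IsCompetitiveRatio ℝ B m T R →
  ∃[ R′ ] (IsCompetitiveRatio ℝ B m T′ R′ × R′ ≤ R)
competitiveRatio-antitone ℝ B (ℕ.suc m) 1≤m T T′ T≤T′ {R} (0<T , R-upper , _) =
  -- Completeness asks for an instance and an upper bound. The old ratio `R` is such a bound, so the
  -- supremum `R′` exists and is at most `R`.
  let R′ , R′-sup = complete (ratio ℝ B _ T′) someInstance (R , ratio-≤R)
  in R′ , ((λ I → <-≤-trans (0<T I) (T≤T′ _)) , R′-sup) , proj₂ R′-sup R ratio-≤R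
  where
  open RealNumbers ℝ
  open RealProperties ℝ

  someInstance : Instance ℝ B (ℕ.suc m)
  someInstance = record
    -- One packet for each buffer; as there is at least one buffer, the input contains a packet.
    { input    = Vec.replicate _ 1 ∷ []
    ; nonEmpty = ℕ.s≤s ℕ.z≤n
    ; opt      = _
    ; isOPT    = IntegralProperties.isOPT-singleton B (ℕ.suc m) (Vec.replicate _ 1)
    }

  ratio-≤R : UpperBound (ratio ℝ B _ T′) R
  ratio-≤R I = ≤-trans
    (*-monoʳ-≤ (fromℕ-nonNeg (Instance.opt I)) (⁻¹-anti-≤ (0<T I) (T≤T′ (Instance.input I))))
    (R-upper I)

lemma13 : (ℝ : RealNumbers) (let open RealNumbers ℝ) →
    (B m : ℕ) → 1 ℕ.≤ B → 1 ℕ.≤ m →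
    (RAND : RandomizedAlgorithm ℝ B m) (R : Carrier) →
    IsCompetitiveRatio ℝ B m (RandomizedAlgorithm.expectedThroughput RAND) R →
    Σ[ FRAC ∈ FractionalAlgorithm ℝ B m ] ∃[ R′ ]
    (IsCompetitiveRatio ℝ B m (FractionalAlgorithm.throughputᶠ FRAC) R′ × R′ ≤ R)
lemma13 ℝ B m _ 1≤m RAND R isRatio =
  FRAC , competitiveRatio-antitone ℝ B m 1≤m _ _ expectedThroughput-≤ isRatio
  where open Derandomization ℝ B m RAND
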